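{- Let $\gamma \geq 0$ be an integer. For all words $x$ and $y$ of $\mathsf{Dias}_\gamma$ of arities at least $2$, and all positions $i$ of $x$, the partial composition of $\mathsf{Dias}_\gamma$ over the $\mathsf{K}$-basis satisfies $$\mathsf{K}^{(\gamma)}_x \circ_i \mathsf{K}^{(\gamma)}_y = \begin{cases} \mathsf{K}^{(\gamma)}_{x \circ_i y} & \text{if } \min(y) > x_i, \\ \sum_{a \in [x_i, \gamma]} \mathsf{K}^{(\gamma)}_{x \circ_{a, i} y} & \text{if } \min(y) = x_i, \\ 0 & \text{otherwise (that is, } \min(y) < x_i\text{)}. \end{cases}$$
   Context: The ground field has characteristic zero. $[\gamma] = \{1, \dots, \gamma\}$, and $[x_i, \gamma]$ is the set of integers $a$ with $x_i \leq a \leq \gamma$. $\mathsf{Dias}_\gamma$ is the nonsymmetric operad whose component of arity $n \geq 1$ is the linear span of the words of length $n$ on $\{0\} \cup [\gamma]$ having exactly one occurrence of $0$ (called the words of $\mathsf{Dias}_\gamma$), with partial compositions defined linearly by $u \circ_i v := u_1 \dots u_{i-1}\, \max(u_i, v_1) \dots \max(u_i, v_m)\, u_{i+1} \dots u_n$ for words $u$ of length $n$ and $v$ of length $m$, and with unit the word $0$. Order: for words $x, y$ of $\mathsf{Dias}_\gamma$ of the same arity $n$, $x \preccurlyeq_\gamma y$ if $x_j \leq y_j$ for all $j \in [n]$. With $\mu_\gamma$ the Möbius function of this poset, set $\mathsf{K}^{(\gamma)}_x := \sum_{x \preccurlyeq_\gamma x'} \mu_\gamma(x, x')\, x'$, the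 sum being over words $x'$ of $\mathsf{Dias}_\gamma$. The family of all $\mathsf{K}^{(\gamma)}_x$ is a basis of $\mathsf{Dias}_\gamma$, called the $\mathsf{K}$-basis. For a word $y$ of $\mathsf{Dias}_\gamma$ of length at least $2$, $\min(y)$ denotes the smallest letter of $y$ among its letters different from $0$. For words $x, y$ of $\mathsf{Dias}_\gamma$, a position $i$ with $x_i \neq 0$, and $a \in [\gamma]$, $x \circ_{a, i} y$ denotes the word $x \circ_i y$ in which the letter coming from the $0$ of $y$ is replaced by $a$ (instead of being $x_i$). -}

module Defs where

open import Algebra.Apartness.Bundles using (HeytingField; HeytingCommutativeRing)
open import Algebra.Bundles using (CommutativeRing)
import Algebra.Construct.NaturalChoice.Max as NaturalMax
import Algebra.Definitions.RawMonoid as RawMonoidDefinitions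
open import Data.Bool using (if_then_else_)
open import Data.Empty using (⊥-elim)
open import Data.Fin using (Fin; zero; suc; toℕ; fromℕ; _≤_)
open import Data.Fin.Properties as Fin
  using (_≟_; _≤?_; all?; ≤-totalOrder)
open import Data.List using (List; []; _∷_; foldr; filter; mapMaybe; cartesianProductWith; allFin)
open import Data.List.Extrema using (min; argmin-all)
open import Data.List.Membership.Propositional using (_∈_)
open import Data.List.Membership.Propositional.Properties
  using (∈-allFin; ∈-cartesianProductWith⁺)
open import Data.List.Relation.Unary.All as All using (All)
open import Data.List.Relation.Unary.All.Properties using (all-filter)
open import Data.List.Relation.Unary.AllPairs using ([]; _∷_)
open import Data.List.Relation.Unary.Any using (here; there)
open import Data.List.Relation.Unary.Unique.Propositional using (Unique)
open import Data.List.Relation.Unary.Unique.Propositional.Properties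
  using (allFin⁺; cartesianProductWith⁺)
open import Data.Maybe as Maybe using (Maybe)
open import Data.Nat as ℕ using (ℕ; _+_)
open import Data.Nat.Induction using (<-wellFounded)
import Data.Nat.Properties as ℕ
open import Data.Product using (_×_; _,_)
open import Data.Vec as Vec using (Vec; []; _∷_; _++_; cast; count; lookup; map; toList)
open import Data.Vec.Properties using (≡-dec; ∷-injective)
open import Function using (_∘_; id)
open import Induction.WellFounded as WF using (WellFounded; WfRec; module Subrelation)
import Relation.Binary.Construct.On as On
open import Relation.Binary.Definitions using (DecidableEquality)
open import Relation.Binary.PropositionalEquality
open import Relation.Nullary using (Dec; yes; no; does; ¬?; _×-dec_; dec⇒maybe; map′)

private
  variable
    A : Set
    γ m n : ℕ

CharacteristicZero : ∀ {c ℓ₁ ℓ₂} → HeytingField c ℓ₁ ℓ₂ → Set ℓ₁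
CharacteristicZero F = ∀ k → k ×′ 1# ≈ 0# → k ≡ 0
  where
  open HeytingField F using (_≈_; 0#; 1#; heytingCommutativeRing)
  open HeytingCommutativeRing heytingCommutativeRing using (commutativeRing)
  open RawMonoidDefinitions (CommutativeRing.+-rawMonoid commutativeRing)
    using () renaming (_×_ to _×′_)

-- The alphabet {0} ∪ [γ].
Letter : ℕ → Set
Letter γ = Fin (ℕ.suc γ)

module _ {γ : ℕ} where
  open NaturalMax (≤-totalOrder (ℕ.suc γ)) public
    using (_⊔_; x≤x⊔y; x≤y⊔x; x≤y⇒x⊔y≈y)

zeros : Vec (Letter γ) n → ℕ
zeros = count (_≟ zero)

record Word (γ n : ℕ) : Set where
  constructor _,_
  field
    letters : Vec (Letter γ) n
    oneZero : zeros letters ≡ 1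

open Word public

letter : Word γ n → Fin n → Letter γ
letter x = lookup (letters x)

letters-injective : {x y : Word γ n} → letters x ≡ letters y → x ≡ y
letters-injective {x = u , p} {_ , q} refl = cong (u ,_) (ℕ.≡-irrelevant p q)

infix 4 _≟ʷ_
_≟ʷ_ : DecidableEquality (Word γ n)
x ≟ʷ y = map′ letters-injective (cong letters) (≡-dec _≟_ (letters x) (letters y))

vectors : ∀ γ n → List (Vec (Letter γ) n)
vectors γ ℕ.zero    = [] ∷ []
vectors γ (ℕ.suc n) = cartesianProductWith _∷_ (allFin (ℕ.suc γ)) (vectors γ n)

toWord? : Vec (Letter γ) n → Maybe (Word γ n)
toWord? u = Maybe.map (u ,_) (dec⇒maybe (zeros u ℕ.≟ 1))

words : ∀ γ n → List (Word γ n)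
words γ n = mapMaybe toWord? (vectors γ n)

vectors-complete : (u : Vec (Letter γ) n) → u ∈ vectors γ n
vectors-complete []       = here refl
vectors-complete (a ∷ u) = ∈-cartesianProductWith⁺ _∷_ (∈-allFin a) (vectors-complete u)

vectors-unique : ∀ γ n → Unique (vectors γ n)
vectors-unique γ ℕ.zero    = All.[] ∷ []
vectors-unique γ (ℕ.suc n) =
  cartesianProductWith⁺ _∷_ ∷-injective (allFin⁺ (ℕ.suc γ)) (vectors-unique γ n)

words-complete : (x : Word γ n) → x ∈ words γ n
words-complete {γ} {n} (u , p) = go (vectors-complete u)
  where
  go : ∀ {us} → u ∈ us → (u , p) ∈ mapMaybe toWord? us
  go (here refl) with zeros u ℕ.≟ 1
  ... | yes q = here (letters-injective refl)
  ... | no ¬q = ⊥-elim (¬q p)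
  go {v ∷ _} (there u∈) with zeros v ℕ.≟ 1
  ... | yes _ = there (go u∈)
  ... | no  _ = go u∈

words-unique : ∀ γ n → Unique (words γ n)
words-unique γ n = go (vectors-unique γ n)
  where
  fresh : ∀ {u p us} → All (u ≢_) us → All ((u , p) ≢_) (mapMaybe (toWord? {γ} {n}) us)
  fresh All.[] = All.[]
  fresh {us = v ∷ _} (u≢v All.∷ rest) with zeros v ℕ.≟ 1
  ... | yes _ = (u≢v ∘ cong letters) All.∷ fresh rest
  ... | no  _ = fresh rest
  go : ∀ {us} → Unique us → Unique (mapMaybe (toWord? {γ} {n}) us)
  go [] = []
  go {u ∷ _} (u∉ ∷ rest) with zeros u ℕ.≟ 1
  ... | yes _ = fresh u∉ ∷ go rest
  ... | no  _ = go rest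

-- Replaces the entry at position i by the block w.  Since the first
-- argument has length n + 1, the result has length (n + 1) + m - 1.
splice : Vec A (ℕ.suc n) → Fin (ℕ.suc n) → Vec A m → Vec A (n + m)
splice {n = n} {m} (_ ∷ u) zero w = cast (ℕ.+-comm m n) (w ++ u)
splice {n = ℕ.suc _} (a ∷ u) (suc i) w = a ∷ splice u i w

zeros-cast : ∀ .(eq : m ≡ n) (u : Vec (Letter γ) m) → zeros (cast eq u) ≡ zeros u
zeros-cast {n = ℕ.zero}  eq []           = refl
zeros-cast {n = ℕ.suc _} eq (zero ∷ u)  = cong ℕ.suc (zeros-cast (ℕ.suc-injective eq) u)
zeros-cast {n = ℕ.suc _} eq (suc _ ∷ u) = zeros-cast (ℕ.suc-injective eq) u

zeros-++ : (u : Vec (Letter γ) m) (v : Vec (Letter γ) n) → zeros (u ++ v) ≡ zeros u + zeros v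
zeros-++ []          v = refl
zeros-++ (zero ∷ u)  v = cong ℕ.suc (zeros-++ u v)
zeros-++ (suc _ ∷ u) v = zeros-++ u v

zeros-splice : (u : Vec (Letter γ) (ℕ.suc n)) (i : Fin (ℕ.suc n)) (w : Vec (Letter γ) m) →
               zeros (lookup u i ∷ []) + zeros (splice u i w) ≡ zeros u + zeros w
zeros-splice {n = n} {m} (a ∷ u) zero w =
  begin
    zeros (a ∷ []) + zeros (cast (ℕ.+-comm m n) (w ++ u))
      ≡⟨ cong (zeros (a ∷ []) +_) (trans (zeros-cast (ℕ.+-comm m n) (w ++ u)) (zeros-++ w u)) ⟩
    zeros (a ∷ []) + (zeros w + zeros u)
      ≡⟨ cong (zeros (a ∷ []) +_) (ℕ.+-comm (zeros w) (zeros u)) ⟩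
    zeros (a ∷ []) + (zeros u + zeros w)
      ≡⟨ sym (ℕ.+-assoc (zeros (a ∷ [])) (zeros u) (zeros w)) ⟩
    zeros (a ∷ []) + zeros u + zeros w
      ≡⟨ cong (_+ zeros w) (sym (zeros-++ (a ∷ []) u)) ⟩
    zeros (a ∷ u) + zeros w
  ∎
  where open ≡-Reasoning
zeros-splice {n = ℕ.suc _} (zero ∷ u) (suc i) w =
  trans (ℕ.+-suc (zeros (lookup u i ∷ [])) _) (cong ℕ.suc (zeros-splice u i w))
zeros-splice {n = ℕ.suc _} (suc _ ∷ u) (suc i) w = zeros-splice u i w

zero⊔ : (b : Letter γ) → zero ⊔ b ≡ b
zero⊔ b = x≤y⇒x⊔y≈y ℕ.z≤n

suc≤⇒≢zero : (a : Fin γ) {b : Letter γ} → suc a ≤ b → b ≢ zero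
suc≤⇒≢zero a () refl

suc⊔≢zero : (a : Fin γ) (b : Letter γ) → suc a ⊔ b ≢ zero
suc⊔≢zero a b = suc≤⇒≢zero a (x≤x⊔y (suc a) b)

zeros-map-≢ : {f : Letter γ → Letter γ} → (∀ b → f b ≢ zero) →
              (v : Vec (Letter γ) n) → zeros (map f v) ≡ 0
zeros-map-≢ f≢ [] = refl
zeros-map-≢ {f = f} f≢ (b ∷ v) with f b in eq
... | zero  = ⊥-elim (f≢ b eq)
... | suc _ = zeros-map-≢ f≢ v

zeros-map-zero⊔ : (v : Vec (Letter γ) n) → zeros (map (zero ⊔_) v) ≡ zeros v
zeros-map-zero⊔ [] = refl
zeros-map-zero⊔ (b ∷ v) rewrite zero⊔ b with b
... | zero  = cong ℕ.suc (zeros-map-zero⊔ v)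
... | suc _ = zeros-map-zero⊔ v

infixl 7 _∘[_]_
_∘[_]_ : Word γ (ℕ.suc n) → Fin (ℕ.suc n) → Word γ m → Word γ (n + m)
_∘[_]_ {γ} (u , p) i (v , q) = splice u i (map (lookup u i ⊔_) v) , one
  where
  one : zeros (splice u i (map (lookup u i ⊔_) v)) ≡ 1
  one with lookup u i | zeros-splice u i (map (lookup u i ⊔_) v)
  ... | zero  | e = ℕ.suc-injective (trans e (cong₂ _+_ p (trans (zeros-map-zero⊔ v) q)))
  ... | suc a | e = trans e (cong₂ _+_ p (zeros-map-≢ (suc⊔≢zero a) v))

-- Here and in compose-replacing, a : Fin γ stands for the letter suc a of [γ].
maxOrReplace : Letter γ → Fin γ → Letter γ → Letter γ
maxOrReplace c a zero    = suc a
maxOrReplace c a (suc b) = c ⊔ suc b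

maxOrReplace≢zero : (c : Letter γ) (a : Fin γ) (b : Letter γ) → maxOrReplace c a b ≢ zero
maxOrReplace≢zero c a zero ()
maxOrReplace≢zero c a (suc b) = suc≤⇒≢zero b (x≤y⊔x c (suc b))

compose-replacing : (x : Word γ (ℕ.suc n)) (i : Fin (ℕ.suc n)) → letter x i ≢ zero →
                    Fin γ → Word γ m → Word γ (n + m)
compose-replacing {γ} (u , p) i uᵢ≢0 a (v , q) = splice u i w , one
  where
  w = map (maxOrReplace (lookup u i) a) v

  one : zeros (splice u i w) ≡ 1
  one with lookup u i | zeros-splice u i w
  ... | zero  | _ = ⊥-elim (uᵢ≢0 refl)
  ... | suc _ | e = trans e (cong₂ _+_ p (zeros-map-≢ (maxOrReplace≢zero _ a) v))

nonzeroLetters : Word γ n → List (Letter γ)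
nonzeroLetters y = filter (λ b → ¬? (b ≟ zero)) (toList (letters y))

-- A word of length at least 2 has a nonzero letter, so the default
-- value γ, being the largest letter, does not affect the minimum.
minLetter : Word γ (2 + n) → Letter γ
minLetter {γ} y = min (≤-totalOrder (ℕ.suc γ)) (fromℕ γ) (nonzeroLetters y)

minLetter≢0 : (y : Word γ (2 + n)) → minLetter y ≢ zero
minLetter≢0 {ℕ.zero} ((zero ∷ zero ∷ _) , ())
minLetter≢0 {ℕ.suc γ} y =
  argmin-all (≤-totalOrder (2 + γ)) id {fromℕ (ℕ.suc γ)} {P = _≢ zero} (λ ())
    (all-filter (λ b → ¬? (b ≟ zero)) (toList (letters y)))

infix 4 _≼_ _≺_ _≼?_ _≺?_

_≼_ : Word γ n → Word γ n → Set
x ≼ y = ∀ j → letter x j ≤ letter y j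

_≺_ : Word γ n → Word γ n → Set
x ≺ y = x ≼ y × x ≢ y

_≼?_ : (x y : Word γ n) → Dec (x ≼ y)
x ≼? y = all? λ j → letter x j ≤? letter y j

_≺?_ : (x y : Word γ n) → Dec (x ≺ y)
x ≺? y = (x ≼? y) ×-dec ¬? (x ≟ʷ y)

weight : Vec (Letter γ) n → ℕ
weight = Vec.sum ∘ map toℕ

weight-mono-≤ : (u v : Vec (Letter γ) n) → (∀ j → lookup u j ≤ lookup v j) →
                weight u ℕ.≤ weight v
weight-mono-≤ []      []      u≤v = ℕ.z≤n
weight-mono-≤ (a ∷ u) (b ∷ v) u≤v = ℕ.+-mono-≤ (u≤v zero) (weight-mono-≤ u v (u≤v ∘ suc))

weight-mono-< : (u v : Vec (Letter γ) n) → (∀ j → lookup u j ≤ lookup v j) → u ≢ v →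
                weight u ℕ.< weight v
weight-mono-< []      []      u≤v u≢v = ⊥-elim (u≢v refl)
weight-mono-< (a ∷ u) (b ∷ v) u≤v u≢v with a ≟ b
... | yes refl =
  ℕ.+-monoʳ-< (toℕ a) (weight-mono-< u v (u≤v ∘ suc) (u≢v ∘ cong (a ∷_)))
... | no a≢b =
  ℕ.+-mono-<-≤ (Fin.≤∧≢⇒< (u≤v zero) a≢b) (weight-mono-≤ u v (u≤v ∘ suc))

≺-wellFounded : WellFounded (_≺_ {γ} {n})
≺-wellFounded =
  Subrelation.wellFounded
    (λ {x} {y} (x≼y , x≢y) → weight-mono-< (letters x) (letters y) x≼y (x≢y ∘ letters-injective))
    (On.wellFounded (weight ∘ letters) <-wellFounded)

module Dias {c ℓ₁ ℓ₂} (F : HeytingField c ℓ₁ ℓ₂) (γ : ℕ) where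

  open HeytingField F
    using (Carrier; 0#; 1#; -_)
    renaming (_≈_ to _≈ᶠ_; _+_ to _+ᶠ_; _*_ to _*ᶠ_)

  ∑ᶠ : ∀ {A : Set} → List A → (A → Carrier) → Carrier
  ∑ᶠ as f = foldr (λ a s → f a +ᶠ s) 0# as

  -- There are finitely many words of each length, so an element of
  -- their linear span is an arbitrary family of coefficients.
  Component : ℕ → Set c
  Component n = Word γ n → Carrier

  infix  4 _≈_
  infixr 7 _·_

  _≈_ : Component n → Component n → Set ℓ₁
  f ≈ g = ∀ w → f w ≈ᶠ g w

  0ᴰ : Component n
  0ᴰ w = 0#

  _·_ : Carrier → Component n → Component n
  (k · f) w = k *ᶠ f w

  ∑ : ∀ {A : Set} → List A → (A → Component n) → Component n
  ∑ as f w = ∑ᶠ as λ a → f a w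

  ⟦_⟧ : Word γ n → Component n
  ⟦ x ⟧ w = if does (x ≟ʷ w) then 1# else 0#

  infixl 7 _∘⟨_⟩_
  _∘⟨_⟩_ : Component (ℕ.suc n) → Fin (ℕ.suc n) → Component m → Component (n + m)
  f ∘⟨ i ⟩ g =
    ∑ (words γ _) λ u → ∑ (words γ _) λ v → (f u *ᶠ g v) · ⟦ u ∘[ i ] v ⟧

  -- μ(x,x) = 1 and μ(x,z) = - Σ_{x ≼ y ≺ z} μ(x,y) for x ≺ z; the sum
  -- is empty when x ⋠ z.
  μ-step : (x z : Word γ n) → WfRec _≺_ (λ _ → Carrier) z → Carrier
  μ-step x z μ[x,_] =
    if does (x ≟ʷ z)
    then 1#
    else - ∑ᶠ (filter (x ≼?_) (words γ _)) λ y → below (y ≺? z)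
    where
    below : ∀ {y} → Dec (y ≺ z) → Carrier
    below (yes y≺z) = μ[x,_] y≺z
    below (no _)    = 0#

  μ : Word γ n → Word γ n → Carrier
  μ x = WF.All.wfRec ≺-wellFounded c (λ _ → Carrier) (μ-step x)

  K : Word γ n → Component n
  K x = ∑ (filter (x ≼?_) (words γ _)) λ x′ → μ x x′ · ⟦ x′ ⟧

{-# OPTIONS --safe #-}
module Submission where

-- The order is a product of chains, the letter 0 being comparable only to itself inside a
-- word.  So K_x is the tensor product over the letters a of x of the vectors
-- k_a = a − (a + 1), where γ + 1 is read as the zero vector, and k_0 is the letter 0.
-- Composing at i replaces the letter c = x_i by y with max(c, –) applied to each letter,
-- and this map sends k_b to k_b if c ≤ b, to 0 if 0 < b < c, and k_0 to the letter c.  Hence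
-- k_c contributes the difference of the images of K_y under max(c, –) and max(c + 1, –):
-- both are given by tensor products if c < min(y), only the second vanishes if c = min(y),
-- and both vanish if min(y) < c.  In the middle case the letter c that remains is expanded
-- as the telescoping sum of k_a over a ≥ c.

open import Defs
open import Algebra.Apartness.Bundles using (HeytingField; HeytingCommutativeRing)
open import Algebra.Bundles using (CommutativeRing)
import Algebra.Construct.NaturalChoice.Max as NaturalMax
import Algebra.Properties.AbelianGroup as AbelianGroupProperties
import Algebra.Properties.CommutativeSemigroup as CommutativeSemigroupProperties
import Algebra.Properties.Group as GroupProperties
import Algebra.Properties.Ring as RingProperties
open import Data.Bool using (Bool; if_then_else_)
open import Data.Empty using (⊥; ⊥-elim)
open import Data.Fin using (Fin; zero; suc; toℕ; fromℕ; _≤_; _<_)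
open import Data.Fin.Properties as Fin using (_≟_; _≤?_; all?; ≤-totalOrder)
open import Data.List as List using (List; []; _∷_; filter; allFin)
open import Data.List.Extrema using (min≤xs; argmin-sel)
open import Data.List.Membership.Propositional using (_∈_)
open import Data.List.Membership.Propositional.Properties using (∈-filter⁺; ∈-filter⁻)
open import Data.List.Properties using (map-tabulate)
open import Data.List.Relation.Unary.All as All using ([]; _∷_)
open import Data.List.Relation.Unary.AllPairs using ([]; _∷_)
open import Data.List.Relation.Unary.Any as List-Any using (here; there)
open import Data.List.Relation.Unary.Unique.Propositional using (Unique)
open import Data.Nat as ℕ using (ℕ)
import Data.Nat.Properties as ℕ
open import Data.Product using (_×_; _,_; proj₁; proj₂)
open import Data.Sum using (inj₁; inj₂)
open import Data.Unit using (tt)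
open import Data.Vec using (Vec; []; _∷_; _++_; cast; lookup; map)
open import Data.Vec.Properties using (cast-is-id; ≡-dec; ∷-injective)
open import Data.Vec.Relation.Binary.Pointwise.Extensional using (ext; extensional⇒inductive)
open import Data.Vec.Relation.Binary.Pointwise.Inductive as Pointwise using (Pointwise; []; _∷_)
open import Data.Vec.Relation.Unary.All as Allᵛ using ([]; _∷_)
import Data.Vec.Relation.Unary.All.Properties as Allᵛ
open import Data.Vec.Relation.Unary.Any as Anyᵛ using (here; there)
import Data.Vec.Relation.Unary.Any.Properties as Anyᵛ
open import Function using (_∘_; id)
open import Induction.WellFounded as WF using (WfRec)
import Level
open import Relation.Binary.PropositionalEquality as ≡ using (_≡_; _≢_; refl; subst)
open import Relation.Nullary using (Dec; yes; no; does; _×-dec_; ¬?; ¬_)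
open import Relation.Nullary.Decidable using (decidable-stable)
open import Relation.Unary using (Decidable)

private
  variable
    m n : ℕ

module Functionals {c ℓ₁ ℓ₂} (F : HeytingField c ℓ₁ ℓ₂) (γ : ℕ) where

  open Dias F γ using (∑ᶠ)
  open HeytingCommutativeRing (HeytingField.heytingCommutativeRing F) using (commutativeRing)
  open CommutativeRing commutativeRing hiding (refl; zero)
  open CommutativeRing commutativeRing using () renaming (refl to ≈-refl)
  open GroupProperties +-group using (x≈y⇒x∙y⁻¹≈ε; x∙y⁻¹≈ε⇒x≈y; ⁻¹-involutive; ε⁻¹≈ε)
  open AbelianGroupProperties +-abelianGroup using (⁻¹-∙-comm)
  open CommutativeSemigroupProperties +-commutativeSemigroup using (interchange)
  open RingProperties ring using (-1*x≈-x; x[y-z]≈xy-xz)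
  open import Relation.Binary.Reasoning.Setoid setoid

  private
    variable
      A B : Set

  -- Indicators, linear functionals and finite sums of scalars.

  [_] : Dec A → Carrier
  [ d ] = if does d then 1# else 0#

  if-yes : (d : Dec A) {k l : Carrier} → A → (if does d then k else l) ≡ k
  if-yes (yes _) _ = refl
  if-yes (no ¬a) a = ⊥-elim (¬a a)

  if-no : (d : Dec A) {k l : Carrier} → ¬ A → (if does d then k else l) ≡ l
  if-no (yes a) ¬a = ⊥-elim (¬a a)
  if-no (no _)  _  = refl

  [yes] : (d : Dec A) → A → [ d ] ≈ 1#
  [yes] d a = reflexive (if-yes d a)

  [no] : (d : Dec A) → ¬ A → [ d ] ≈ 0#
  [no] d ¬a = reflexive (if-no d ¬a)

  [-]-cong : (d : Dec A) (e : Dec B) → (A → B) → (B → A) → [ d ] ≈ [ e ]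
  [-]-cong (yes a) e f g = sym ([yes] e (f a))
  [-]-cong (no ¬a) e f g = sym ([no] e (¬a ∘ g))

  [-]-× : (d : Dec A) (e : Dec B) → [ d ×-dec e ] ≈ [ d ] * [ e ]
  [-]-× (yes _) e = sym (*-identityˡ _)
  [-]-× (no _)  e = sym (zeroˡ _)

  -- A formal linear combination of elements of `A` is represented by the functional that it induces
  -- on functions `A → Carrier`. Compatibility with `_≈_` is a field because equality of scalars is
  -- not propositional.
  record Linear {A : Set} (L : (A → Carrier) → Carrier) : Set (c Level.⊔ ℓ₁) where
    field
      preserves-≈ : ∀ {f g} → (∀ a → f a ≈ g a) → L f ≈ L g
      preserves-+ : ∀ f g → L (λ a → f a + g a) ≈ L f + L g
      preserves-* : ∀ k f → L (λ a → k * f a) ≈ k * L f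

    preserves-0 : L (λ _ → 0#) ≈ 0#
    preserves-0 = begin
      L (λ _ → 0#)        ≈⟨ preserves-≈ (λ _ → sym (zeroˡ 0#)) ⟩
      L (λ _ → 0# * 0#)   ≈⟨ preserves-* 0# (λ _ → 0#) ⟩
      0# * L (λ _ → 0#)   ≈⟨ zeroˡ _ ⟩
      0#                  ∎

    preserves-neg : ∀ f → L (λ a → - f a) ≈ - L f
    preserves-neg f = begin
      L (λ a → - f a)        ≈⟨ preserves-≈ (λ a → sym (-1*x≈-x (f a))) ⟩
      L (λ a → - 1# * f a)   ≈⟨ preserves-* (- 1#) f ⟩
      - 1# * L f             ≈⟨ -1*x≈-x _ ⟩
      - L f                  ∎

    preserves-minus : ∀ f g → L (λ a → f a - g a) ≈ L f - L g
    preserves-minus f g = trans (preserves-+ f _) (+-congˡ (preserves-neg g))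

  open Linear

  evaluation-linear : (a : A) → Linear (λ f → f a)
  evaluation-linear a = record
    { preserves-≈ = λ f≈g → f≈g a
    ; preserves-+ = λ _ _ → ≈-refl
    ; preserves-* = λ _ _ → ≈-refl
    }

  Linear-resp-≗ : {L M : (A → Carrier) → Carrier} → (∀ f → L f ≡ M f) → Linear M → Linear L
  Linear-resp-≗ {L = L} {M} L≗M Lin = record
    { preserves-≈ = λ {f} {g} f≈g → trans (to f) (trans (preserves-≈ Lin f≈g) (from g))
    ; preserves-+ = λ f g → trans (to _) (trans (preserves-+ Lin f g) (+-cong (from f) (from g)))
    ; preserves-* = λ k f → trans (to _) (trans (preserves-* Lin k f) (*-congˡ (from f)))
    }
    where
    to : ∀ f → L f ≈ M f
    to f = reflexive (L≗M f)
    from : ∀ f → M f ≈ L f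
    from f = sym (to f)

  ∑-linear : (as : List A) → Linear (∑ᶠ as)
  ∑-linear [] .preserves-≈ f≈g = ≈-refl
  ∑-linear [] .preserves-+ f g = sym (+-identityˡ 0#)
  ∑-linear [] .preserves-* k f = sym (zeroʳ k)
  ∑-linear (a ∷ as) .preserves-≈ f≈g = +-cong (f≈g a) (∑-linear as .preserves-≈ f≈g)
  ∑-linear (a ∷ as) .preserves-+ f g =
    trans (+-congˡ (∑-linear as .preserves-+ f g)) (interchange _ _ _ _)
  ∑-linear (a ∷ as) .preserves-* k f =
    trans (+-congˡ (∑-linear as .preserves-* k f)) (sym (distribˡ k _ _))

  ∑-filter : {P : A → Set} (P? : Decidable P) (as : List A) (f : A → Carrier) →
             ∑ᶠ (filter P? as) f ≈ ∑ᶠ as (λ a → [ P? a ] * f a)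
  ∑-filter P? [] f = ≈-refl
  ∑-filter P? (a ∷ as) f with P? a
  ... | yes _ = +-cong (sym (*-identityˡ _)) (∑-filter P? as f)
  ... | no  _ = trans (∑-filter P? as f) (sym (trans (+-congʳ (zeroˡ _)) (+-identityˡ _)))

  ∑-vanishing : (as : List A) {f : A → Carrier} → All.All (λ a → f a ≈ 0#) as → ∑ᶠ as f ≈ 0#
  ∑-vanishing []       []       = ≈-refl
  ∑-vanishing (a ∷ as) (p ∷ ps) = trans (+-cong p (∑-vanishing as ps)) (+-identityˡ 0#)

  ∑-indicator : (_≟ᴬ_ : (a b : A) → Dec (a ≡ b)) {as : List A} {a : A} (f : A → Carrier) →
                Unique as → a ∈ as → ∑ᶠ as (λ b → [ a ≟ᴬ b ] * f b) ≈ f a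
  ∑-indicator _≟ᴬ_ {a ∷ as} f (a∉ ∷ _) (here refl) = begin
    [ a ≟ᴬ a ] * f a + ∑ᶠ as (λ b → [ a ≟ᴬ b ] * f b)
      ≈⟨ +-cong (trans (*-congʳ ([yes] (a ≟ᴬ a) refl)) (*-identityˡ _))
                (∑-vanishing as (All.map (λ a≢b → trans (*-congʳ ([no] (a ≟ᴬ _) a≢b)) (zeroˡ _)) a∉)) ⟩
    f a + 0#   ≈⟨ +-identityʳ _ ⟩
    f a        ∎
  ∑-indicator _≟ᴬ_ {b ∷ as} {a} f (b∉ ∷ unique) (there a∈) = begin
    [ a ≟ᴬ b ] * f b + ∑ᶠ as (λ b → [ a ≟ᴬ b ] * f b)
      ≈⟨ +-cong (trans (*-congʳ ([no] (a ≟ᴬ b) (All.lookup b∉ a∈ ∘ ≡.sym))) (zeroˡ _))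
                (∑-indicator _≟ᴬ_ f unique a∈) ⟩
    0# + f a   ≈⟨ +-identityˡ _ ⟩
    f a        ∎

  ∑-map : (h : A → B) (as : List A) (f : B → Carrier) → ∑ᶠ (List.map h as) f ≡ ∑ᶠ as (f ∘ h)
  ∑-map h []       f = refl
  ∑-map h (a ∷ as) f = ≡.cong (f (h a) +_) (∑-map h as f)

  -- Differences along a chain and their tensor products.

  -- Evaluation at a + 1, where the element after the largest one is read as the zero vector.
  shift : (Fin n → Carrier) → Fin n → Carrier
  shift {ℕ.suc ℕ.zero}    f zero    = 0#
  shift {ℕ.suc (ℕ.suc _)} f zero    = f (suc zero)
  shift {ℕ.suc (ℕ.suc _)} f (suc a) = shift (f ∘ suc) a

  -- A view that replaces the recursion in `shift` by its two outcomes, uniformly in `f`, so that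
  -- later proofs split only on whether `a` is the largest element.
  data Successor (a : Fin n) : Set c where
    top  : (∀ (b : Fin n) → b ≤ a) → (∀ f → shift f a ≡ 0#) → Successor a
    next : (a⁺ : Fin n) → toℕ a⁺ ≡ ℕ.suc (toℕ a) → (∀ f → shift f a ≡ f a⁺) → Successor a

  successor : (a : Fin n) → Successor a
  successor {ℕ.suc ℕ.zero}    zero = top (λ { zero → ℕ.z≤n }) (λ _ → refl)
  successor {ℕ.suc (ℕ.suc _)} zero = next (suc zero) refl (λ _ → refl)
  successor {ℕ.suc (ℕ.suc _)} (suc a) with successor a
  ... | top  ≤a s     = top (λ { zero → ℕ.z≤n ; (suc b) → ℕ.s≤s (≤a b) }) (λ f → s (f ∘ suc))
  ... | next a⁺ eq s  = next (suc a⁺) (≡.cong ℕ.suc eq) (λ f → s (f ∘ suc))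

  shift-linear : (a : Fin n) → Linear (λ f → shift f a)
  shift-linear a with successor a
  ... | top _ s    = Linear-resp-≗ s (∑-linear [])
  ... | next b _ s = Linear-resp-≗ s (evaluation-linear b)

  -- pair x φ is the linear extension of φ evaluated at the tensor product, over the letters
  -- a of x, of a − (a + 1) if 0 < a < γ, and of a itself if a = 0 or a = γ.
  pairLetter : Letter γ → (Letter γ → Carrier) → Carrier
  pairLetter zero      f = f zero
  pairLetter a@(suc _) f = f a - shift f a

  pair : Vec (Letter γ) n → (Vec (Letter γ) n → Carrier) → Carrier
  pair []      φ = φ []
  pair (a ∷ x) φ = pairLetter a λ b → pair x λ v → φ (b ∷ v)

  pairLetter-linear : ∀ a → Linear (pairLetter a)
  pairLetter-linear zero = evaluation-linear zero
  pairLetter-linear a@(suc _) = record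
    { preserves-≈ = λ f≈g → +-cong (f≈g a) (-‿cong (preserves-≈ S f≈g))
    ; preserves-+ = λ f g → trans (+-congˡ (trans (-‿cong (preserves-+ S f g)) (sym (⁻¹-∙-comm _ _))))
                                  (interchange _ _ _ _)
    ; preserves-* = λ k f → trans (+-congˡ (-‿cong (preserves-* S k f))) (sym (x[y-z]≈xy-xz k _ _))
    }
    where
    S = shift-linear a

  pair-linear : (x : Vec (Letter γ) n) → Linear (pair x)
  pair-linear [] = evaluation-linear []
  pair-linear (a ∷ x) = record
    { preserves-≈ = λ f≈g → preserves-≈ La λ b → preserves-≈ Lx λ v → f≈g (b ∷ v)
    ; preserves-+ = λ f g → trans (preserves-≈ La λ b → preserves-+ Lx _ _) (preserves-+ La _ _)
    ; preserves-* = λ k f → trans (preserves-≈ La λ b → preserves-* Lx k _) (preserves-* La k _)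
    }
    where
    La = pairLetter-linear a
    Lx = pair-linear x

  shift-swap : {L : (A → Carrier) → Carrier} → Linear L → (a : Fin n) (f : Fin n → A → Carrier) →
               L (λ v → shift (λ b → f b v) a) ≈ shift (λ b → L (f b)) a
  shift-swap Lin a f with successor a
  ... | top  _ s   = trans (preserves-≈ Lin λ v → reflexive (s _))
                           (trans (preserves-0 Lin) (reflexive (≡.sym (s _))))
  ... | next _ _ s = trans (preserves-≈ Lin λ v → reflexive (s _)) (reflexive (≡.sym (s _)))

  pairLetter-swap : {L : (A → Carrier) → Carrier} → Linear L →
                    (a : Letter γ) (f : Letter γ → A → Carrier) →
                    L (λ v → pairLetter a (λ b → f b v)) ≈ pairLetter a (λ b → L (f b))
  pairLetter-swap Lin zero      f = ≈-refl
  pairLetter-swap Lin a@(suc _) f =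
    trans (preserves-minus Lin _ _) (+-congˡ (-‿cong (shift-swap Lin a f)))

  -- `pair x` is a finite signed combination of evaluations, hence it commutes with every linear
  -- functional. This is how sums and pairings are exchanged below.
  pair-swap : {L : (A → Carrier) → Carrier} → Linear L →
              (x : Vec (Letter γ) n) (f : Vec (Letter γ) n → A → Carrier) →
              L (λ v → pair x (λ u → f u v)) ≈ pair x (λ u → L (f u))
  pair-swap Lin []      f = ≈-refl
  pair-swap Lin (a ∷ x) f =
    trans (pairLetter-swap Lin a _)
          (preserves-≈ (pairLetter-linear a) λ b → pair-swap Lin x λ u → f (b ∷ u))

  -- Sampled a b: pairLetter a may evaluate its argument at b.
  data Sampled (a : Letter γ) : Letter γ → Set where
    stay : Sampled a a
    step : ∀ {b} → a ≢ zero → toℕ b ≡ ℕ.suc (toℕ a) → Sampled a b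

  Sampledᵛ : Vec (Letter γ) n → Vec (Letter γ) n → Set
  Sampledᵛ = Pointwise Sampled

  pairLetter-cong : ∀ a {f g} → (∀ {b} → Sampled a b → f b ≈ g b) → pairLetter a f ≈ pairLetter a g
  pairLetter-cong zero      f≈g = f≈g stay
  pairLetter-cong a@(suc _) {f} {g} f≈g = +-cong (f≈g stay) (-‿cong shifted)
    where
    shifted : shift f a ≈ shift g a
    shifted with successor a
    ... | top _ s      = reflexive (≡.trans (s f) (≡.sym (s g)))
    ... | next a⁺ eq s = trans (reflexive (s f)) (trans (f≈g (step (λ ()) eq)) (reflexive (≡.sym (s g))))

  -- Agreement on the support of the tensor product is enough, so facts that hold only for sampled
  -- vectors can be used under `pair`.
  pair-cong : (x : Vec (Letter γ) n) {φ ψ : Vec (Letter γ) n → Carrier} →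
              (∀ {v} → Sampledᵛ x v → φ v ≈ ψ v) → pair x φ ≈ pair x ψ
  pair-cong []      φ≈ψ = φ≈ψ []
  pair-cong (a ∷ x) φ≈ψ = pairLetter-cong a λ s → pair-cong x λ ss → φ≈ψ (s ∷ ss)

  Sampled⇒≤ : ∀ {a b} → Sampled a b → a ≤ b
  Sampled⇒≤ stay        = ℕ.≤-refl
  Sampled⇒≤ (step _ eq) = ℕ.≤-trans (ℕ.n≤1+n _) (ℕ.≤-reflexive (≡.sym eq))

  Sampled⇒≤suc : ∀ {a b} → Sampled a b → toℕ b ℕ.≤ ℕ.suc (toℕ a)
  Sampled⇒≤suc stay        = ℕ.n≤1+n _
  Sampled⇒≤suc (step _ eq) = ℕ.≤-reflexive eq

  Sampled-zero : ∀ {a b} → Sampled a b → b ≡ zero → a ≡ zero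
  Sampled-zero stay        b≡0  = b≡0
  Sampled-zero (step _ ()) refl

  -- The letter 0 is sampled only at itself, and a nonzero letter never moves down. Hence every
  -- vector sampled from a word is again a word.
  zeros-Sampled : {x v : Vec (Letter γ) n} → Sampledᵛ x v → zeros v ≡ zeros x
  zeros-Sampled [] = refl
  zeros-Sampled (_∷_ {x = zero}  stay ss) = ≡.cong ℕ.suc (zeros-Sampled ss)
  zeros-Sampled (_∷_ {x = zero}  (step 0≢0 _) ss) = ⊥-elim (0≢0 refl)
  zeros-Sampled (_∷_ {x = suc _} {zero} s ss) with () ← Sampled-zero s refl
  zeros-Sampled (_∷_ {x = suc _} {suc _} s ss) = zeros-Sampled ss

  Sampled⇒≼ : {x v : Vec (Letter γ) n} → Sampledᵛ x v → ∀ j → lookup x j ≤ lookup v j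
  Sampled⇒≼ ss j = Sampled⇒≤ (Pointwise.lookup ss j)

  -- Inversion of the componentwise order.

  infix 4 _≟ᵛ_ _≼ᵛ?_

  _≟ᵛ_ : (u v : Vec (Letter γ) n) → Dec (u ≡ v)
  _≟ᵛ_ = ≡-dec _≟_

  _≼ᵛ?_ : (u v : Vec (Letter γ) n) → Dec (∀ j → lookup u j ≤ lookup v j)
  u ≼ᵛ? v = all? λ j → lookup u j ≤? lookup v j

  -- For a nonzero, [a ≤ b] - [a + 1 ≤ b] is the indicator of a = b. For a = 0 no difference is
  -- taken, and b must be 0 as well.
  pairLetter-≤ : (a b : Letter γ) → (a ≡ zero → b ≡ zero) →
                 pairLetter a (λ a′ → [ a′ ≤? b ]) ≈ [ a ≟ b ]
  pairLetter-≤ zero b 0⇒0 with refl ← 0⇒0 refl = ≈-refl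
  pairLetter-≤ a@(suc _) b _ = trans (+-congˡ (-‿cong shifted)) (difference (a ≤? b) (a ≟ b))
    where
    shifted : shift (λ a′ → [ a′ ≤? b ]) a ≈ [ a Fin.<? b ]
    shifted with successor a
    ... | top ≤a s = trans (reflexive (s _)) (sym ([no] (a Fin.<? b) λ a<b → ℕ.<⇒≱ a<b (≤a b)))
    ... | next a⁺ eq s = trans (reflexive (s _))
          ([-]-cong (a⁺ ≤? b) (a Fin.<? b) (subst (ℕ._≤ toℕ b) eq) (subst (ℕ._≤ toℕ b) (≡.sym eq)))

    difference : Dec (a ≤ b) → Dec (a ≡ b) → [ a ≤? b ] - [ a Fin.<? b ] ≈ [ a ≟ b ]
    difference (no a≰b) _ = begin
      [ a ≤? b ] - [ a Fin.<? b ]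
        ≈⟨ +-cong ([no] (a ≤? b) a≰b) (-‿cong ([no] (a Fin.<? b) (a≰b ∘ ℕ.<⇒≤))) ⟩
      0# - 0#     ≈⟨ -‿inverseʳ 0# ⟩
      0#          ≈⟨ [no] (a ≟ b) (a≰b ∘ Fin.≤-reflexive) ⟨
      [ a ≟ b ]   ∎
    difference (yes a≤b) (yes a≡b) = begin
      [ a ≤? b ] - [ a Fin.<? b ]
        ≈⟨ +-cong ([yes] (a ≤? b) a≤b) (trans (-‿cong ([no] (a Fin.<? b) (Fin.<-irrefl a≡b))) ε⁻¹≈ε) ⟩
      1# + 0#     ≈⟨ +-identityʳ 1# ⟩
      1#          ≈⟨ [yes] (a ≟ b) a≡b ⟨
      [ a ≟ b ]   ∎
    difference (yes a≤b) (no a≢b) = begin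
      [ a ≤? b ] - [ a Fin.<? b ]
        ≈⟨ +-cong ([yes] (a ≤? b) a≤b) (-‿cong ([yes] (a Fin.<? b) (Fin.≤∧≢⇒< a≤b a≢b))) ⟩
      1# - 1#     ≈⟨ -‿inverseʳ 1# ⟩
      0#          ≈⟨ [no] (a ≟ b) a≢b ⟨
      [ a ≟ b ]   ∎

  -- The indicator of v ≼ z is a product over the letters, so the one-letter case multiplies up. In
  -- terms of coefficients, their sum over all v ≼ z is the Kronecker delta, which is the defining
  -- property of the Möbius function.
  pair-≼ : (x z : Vec (Letter γ) n) → (∀ j → lookup x j ≡ zero → lookup z j ≡ zero) →
           pair x (λ v → [ v ≼ᵛ? z ]) ≈ [ x ≟ᵛ z ]
  pair-≼ [] [] _ = ≈-refl
  pair-≼ (a ∷ x) (b ∷ z) 0⇒0 = begin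
    pairLetter a (λ a′ → pair x (λ v → [ (a′ ∷ v) ≼ᵛ? (b ∷ z) ]))
      ≈⟨ preserves-≈ (pairLetter-linear a) (λ a′ → inner a′) ⟩
    pairLetter a (λ a′ → [ x ≟ᵛ z ] * [ a′ ≤? b ])
      ≈⟨ preserves-* (pairLetter-linear a) _ _ ⟩
    [ x ≟ᵛ z ] * pairLetter a (λ a′ → [ a′ ≤? b ])
      ≈⟨ *-congˡ (pairLetter-≤ a b (0⇒0 zero)) ⟩
    [ x ≟ᵛ z ] * [ a ≟ b ]
      ≈⟨ sym ([-]-× (x ≟ᵛ z) (a ≟ b)) ⟩
    [ (x ≟ᵛ z) ×-dec (a ≟ b) ]
      ≈⟨ [-]-cong ((x ≟ᵛ z) ×-dec (a ≟ b)) ((a ∷ x) ≟ᵛ (b ∷ z))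
           (λ (p , q) → ≡.cong₂ _∷_ q p) (λ p → proj₂ (∷-injective p) , proj₁ (∷-injective p)) ⟩
    [ (a ∷ x) ≟ᵛ (b ∷ z) ] ∎
    where
    inner : ∀ a′ → pair x (λ v → [ (a′ ∷ v) ≼ᵛ? (b ∷ z) ]) ≈ [ x ≟ᵛ z ] * [ a′ ≤? b ]
    inner a′ = begin
      pair x (λ v → [ (a′ ∷ v) ≼ᵛ? (b ∷ z) ])
        ≈⟨ preserves-≈ (pair-linear x) (λ v → trans
             ([-]-cong ((a′ ∷ v) ≼ᵛ? (b ∷ z)) ((a′ ≤? b) ×-dec (v ≼ᵛ? z))
               (λ p → p zero , p ∘ suc) (λ { (p , q) zero → p ; (p , q) (suc j) → q j }))
             ([-]-× (a′ ≤? b) (v ≼ᵛ? z))) ⟩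
      pair x (λ v → [ a′ ≤? b ] * [ v ≼ᵛ? z ])
        ≈⟨ preserves-* (pair-linear x) _ _ ⟩
      [ a′ ≤? b ] * pair x (λ v → [ v ≼ᵛ? z ])
        ≈⟨ *-congˡ (pair-≼ x z (0⇒0 ∘ suc)) ⟩
      [ a′ ≤? b ] * [ x ≟ᵛ z ]
        ≈⟨ *-comm _ _ ⟩
      [ x ≟ᵛ z ] * [ a′ ≤? b ] ∎

  zeros-antitone : (u v : Vec (Letter γ) n) → (∀ j → lookup u j ≤ lookup v j) → zeros v ℕ.≤ zeros u
  zeros-antitone []          []          _   = ℕ.z≤n
  zeros-antitone (zero  ∷ u) (zero  ∷ v) u≤v = ℕ.s≤s (zeros-antitone u v (u≤v ∘ suc))
  zeros-antitone (zero  ∷ u) (suc _ ∷ v) u≤v = ℕ.m≤n⇒m≤1+n (zeros-antitone u v (u≤v ∘ suc))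
  zeros-antitone (suc _ ∷ u) (suc _ ∷ v) u≤v = zeros-antitone u v (u≤v ∘ suc)
  zeros-antitone (suc _ ∷ u) (zero  ∷ v) u≤v with () ← u≤v zero

  -- Raising letters can only destroy zeros, so the zeros of v are among those of u; equal numbers
  -- force equal positions.
  zeros-aligned : (u v : Vec (Letter γ) n) → (∀ j → lookup u j ≤ lookup v j) → zeros u ≡ zeros v →
                  ∀ j → lookup u j ≡ zero → lookup v j ≡ zero
  zeros-aligned (zero  ∷ u) (zero  ∷ v) u≤v eq zero    _   = refl
  zeros-aligned (zero  ∷ u) (zero  ∷ v) u≤v eq (suc j) u≡0 =
    zeros-aligned u v (u≤v ∘ suc) (ℕ.suc-injective eq) j u≡0
  zeros-aligned (zero  ∷ u) (suc _ ∷ v) u≤v eq j _ =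
    ⊥-elim (ℕ.1+n≰n (ℕ.≤-trans (ℕ.≤-reflexive eq) (zeros-antitone u v (u≤v ∘ suc))))
  zeros-aligned (suc _ ∷ u) (suc _ ∷ v) u≤v eq (suc j) u≡0 =
    zeros-aligned u v (u≤v ∘ suc) eq j u≡0
  zeros-aligned (suc _ ∷ u) (zero  ∷ v) u≤v with () ← u≤v zero

  -- The Möbius function and the K-basis as tensor products.

  open Dias F γ using (μ; μ-step; K; _∘⟨_⟩_; ∑)

  -- A functional is recovered from its values on indicators, which are the coefficients of the
  -- tensor product. Summing over words suffices, since only words are sampled from a word.
  ∑-pair : (x : Word γ n) (φ : Vec (Letter γ) n → Carrier) →
           ∑ᶠ (words γ n) (λ u → pair (letters x) (λ v → [ v ≟ᵛ letters u ]) * φ (letters u))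
             ≈ pair (letters x) φ
  ∑-pair {n} x φ = begin
    ∑ᶠ (words γ n) (λ u → pair (letters x) (λ v → [ v ≟ᵛ letters u ]) * φ (letters u))
      ≈⟨ preserves-≈ Σ (λ u → trans (*-comm _ _) (sym (preserves-* Px _ _))) ⟩
    ∑ᶠ (words γ n) (λ u → pair (letters x) (λ v → φ (letters u) * [ v ≟ᵛ letters u ]))
      ≈⟨ pair-swap Σ (letters x) _ ⟩
    pair (letters x) (λ v → ∑ᶠ (words γ n) (λ u → φ (letters u) * [ v ≟ᵛ letters u ]))
      ≈⟨ pair-cong (letters x) (λ {v} ss → trans (preserves-≈ Σ (λ u → *-comm _ _))
           (∑-indicator _≟ʷ_ {a = v , ≡.trans (zeros-Sampled ss) (oneZero x)} (φ ∘ letters)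
             (words-unique γ n) (words-complete _))) ⟩
    pair (letters x) φ ∎
    where
    Σ = ∑-linear (words γ n)
    Px = pair-linear (letters x)

  pair-vanishing : {x z : Word γ n} → ¬ x ≼ z → pair (letters x) (λ v → [ v ≟ᵛ letters z ]) ≈ 0#
  pair-vanishing {x = x} {z} x⋠z = trans
    (pair-cong (letters x) λ {v} ss → [no] (v ≟ᵛ letters z) λ { refl → x⋠z (Sampled⇒≼ ss) })
    (preserves-0 (pair-linear (letters x)))

  -- Unfolding the well-founded recursion behind `μ` requires a step function that is extensional
  -- for `≡`, so `_≈_` is too weak here.
  ∑-cong-≡ : (as : List A) {f g : A → Carrier} → (∀ a → f a ≡ g a) → ∑ᶠ as f ≡ ∑ᶠ as g
  ∑-cong-≡ []       f≡g = refl
  ∑-cong-≡ (a ∷ as) f≡g = ≡.cong₂ _+_ (f≡g a) (∑-cong-≡ as f≡g)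

  if-cong : (b : Bool) {k l l′ : Carrier} → l ≡ l′ →
            (if b then k else l) ≡ (if b then k else l′)
  if-cong b = ≡.cong (if b then _ else_)

  given : Dec A → (A → Carrier) → Carrier
  given (yes a) f = f a
  given (no _)  f = 0#

  given-cong : (d : Dec A) {f g : A → Carrier} → (∀ a → f a ≡ g a) → given d f ≡ given d g
  given-cong (yes a) f≡g = f≡g a
  given-cong (no _)  f≡g = refl

  -- The local function of μ-step has no name here: the left-hand side of below≡given is
  -- left to be inferred from its use in μ-step≡given.
  mutual
    μ-step≡given : (x z : Word γ n) (f : ∀ y → y ≺ z → Carrier) → μ-step x z (λ {y} → f y) ≡
      (if does (x ≟ʷ z) then 1# else
         - ∑ᶠ (filter (x ≼?_) (words γ n)) (λ y → given (y ≺? z) (f y)))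
    μ-step≡given {n} x z f = if-cong (does (x ≟ʷ z))
      (≡.cong -_ (∑-cong-≡ (filter (x ≼?_) (words γ n)) (below≡given x z f)))

    below≡given : (x z : Word γ n) (f : ∀ y → y ≺ z → Carrier) (y : Word γ n) →
                  _ ≡ given (y ≺? z) (f y)
    below≡given x z f y with y ≺? z
    ... | yes _ = refl
    ... | no  _ = refl

  μ-step-ext : (x z : Word γ n) {f g : WfRec _≺_ (λ _ → Carrier) z} →
               (∀ {y} y≺z → f {y} y≺z ≡ g y≺z) → μ-step x z f ≡ μ-step x z g
  μ-step-ext {n} x z {f} {g} f≡g = ≡.trans (μ-step≡given x z λ y → f {y}) (≡.trans
    (if-cong (does (x ≟ʷ z)) (≡.cong -_ (∑-cong-≡ (filter (x ≼?_) (words γ n))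
      λ y → given-cong (y ≺? z) f≡g)))
    (≡.sym (μ-step≡given x z λ y → g {y})))

  μ-unfold : (x z : Word γ n) → μ x z ≡
             (if does (x ≟ʷ z) then 1# else
                - ∑ᶠ (filter (x ≼?_) (words γ n)) (λ y → given (y ≺? z) (λ _ → μ x y)))
  μ-unfold x z = ≡.trans
    (WF.FixPoint.unfold-wfRec ≺-wellFounded (λ _ → Carrier) (μ-step x) (μ-step-ext x) {z})
    (μ-step≡given x z λ y _ → μ x y)

  -- By `pair-≼` the coefficients of the tensor product satisfy the recurrence that defines `μ`;
  -- induction along `_≺_` identifies the two.
  μ≈pair : (x z : Word γ n) → x ≼ z → μ x z ≈ pair (letters x) (λ v → [ v ≟ᵛ letters z ])
  μ≈pair {n} x = WF.All.wfRec ≺-wellFounded _ _ recurrence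
    where
    P : Word γ n → Carrier
    P y = pair (letters x) (λ v → [ v ≟ᵛ letters y ])

    recurrence : ∀ z → WfRec _≺_ (λ z → x ≼ z → μ x z ≈ P z) z → x ≼ z → μ x z ≈ P z
    recurrence z IH x≼z = trans (reflexive (μ-unfold x z)) (by-cases (x ≟ʷ z))
      where
      -- The indicator of v ≺ z is written as a difference, so that linearity reduces its pairing to
      -- `pair-≼`.
      strictlyBelow : Vec (Letter γ) n → Carrier
      strictlyBelow v = [ v ≼ᵛ? letters z ] - [ v ≟ᵛ letters z ]

      pair-strictlyBelow : pair (letters x) strictlyBelow ≈ [ x ≟ʷ z ] - P z
      pair-strictlyBelow =
        trans (preserves-minus (pair-linear (letters x)) _ _) (+-congʳ (pair-≼ (letters x) (letters z)
          (zeros-aligned (letters x) (letters z) x≼z (≡.trans (oneZero x) (≡.sym (oneZero z))))))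

      term : ∀ y → [ x ≼? y ] * given (y ≺? z) (λ _ → μ x y) ≈ P y * strictlyBelow (letters y)
      term y = by-cases′ (x ≼? y) (y ≺? z)
        where
        by-cases′ : Dec (x ≼ y) → (d : Dec (y ≺ z)) →
                    [ x ≼? y ] * given d (λ _ → μ x y) ≈ P y * strictlyBelow (letters y)
        by-cases′ (no x⋠y) _ = trans (trans (*-congʳ ([no] (x ≼? y) x⋠y)) (zeroˡ _))
          (sym (trans (*-congʳ (pair-vanishing {x = x} {y} x⋠y)) (zeroˡ _)))
        by-cases′ (yes x≼y) (yes y≺z) = begin
          [ x ≼? y ] * μ x y   ≈⟨ *-cong ([yes] (x ≼? y) x≼y) (IH y≺z x≼y) ⟩
          1# * P y             ≈⟨ *-comm 1# (P y) ⟩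
          P y * 1#             ≈⟨ *-congˡ (+-identityʳ 1#) ⟨
          P y * (1# + 0#)
            ≈⟨ *-congˡ (+-cong ([yes] (y ≼? z) (proj₁ y≺z))
                               (trans (-‿cong ([no] (y ≟ʷ z) (proj₂ y≺z))) ε⁻¹≈ε)) ⟨
          P y * strictlyBelow (letters y) ∎
        by-cases′ (yes x≼y) (no y⊀z) = trans (zeroʳ _) (sym (trans (*-congˡ (x≈y⇒x∙y⁻¹≈ε
          ([-]-cong (y ≼? z) (y ≟ʷ z)
            (λ y≼z → decidable-stable (y ≟ʷ z) λ y≢z → y⊀z (y≼z , y≢z))
            (λ { refl j → ℕ.≤-refl })))) (zeroʳ _)))

      sum : Carrier
      sum = ∑ᶠ (filter (x ≼?_) (words γ n)) (λ y → given (y ≺? z) (λ _ → μ x y))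

      sum≈ : sum ≈ [ x ≟ʷ z ] - P z
      sum≈ = begin
        sum
          ≈⟨ ∑-filter (x ≼?_) (words γ n) _ ⟩
        ∑ᶠ (words γ n) (λ y → [ x ≼? y ] * given (y ≺? z) (λ _ → μ x y))
          ≈⟨ preserves-≈ (∑-linear (words γ n)) term ⟩
        ∑ᶠ (words γ n) (λ y → P y * strictlyBelow (letters y))
          ≈⟨ ∑-pair x strictlyBelow ⟩
        pair (letters x) strictlyBelow
          ≈⟨ pair-strictlyBelow ⟩
        [ x ≟ʷ z ] - P z ∎

      by-cases : Dec (x ≡ z) → (if does (x ≟ʷ z) then 1# else - sum) ≈ P z
      -- For z = x, sampled vectors lie above x and so never strictly below it; thus
      -- `pair-strictlyBelow` reads 1 - P x = 0.
      by-cases (yes refl) = trans (reflexive (if-yes (x ≟ʷ x) refl))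
        (x∙y⁻¹≈ε⇒x≈y 1# (P x) (begin
          1# - P x
            ≈⟨ +-congʳ ([yes] (x ≟ʷ x) refl) ⟨
          [ x ≟ʷ x ] - P x
            ≈⟨ pair-strictlyBelow ⟨
          pair (letters x) strictlyBelow
            ≈⟨ pair-cong (letters x) (λ {v} ss → x≈y⇒x∙y⁻¹≈ε
                 ([-]-cong (v ≼ᵛ? letters x) (v ≟ᵛ letters x)
                   (λ v≼x → ≼-antisym v≼x (Sampled⇒≼ ss)) (λ { refl j → ℕ.≤-refl }))) ⟩
          pair (letters x) (λ _ → 0#)
            ≈⟨ preserves-0 (pair-linear (letters x)) ⟩
          0# ∎))
        where
        ≼-antisym : {u v : Vec (Letter γ) n} → (∀ j → lookup u j ≤ lookup v j) →
                    (∀ j → lookup v j ≤ lookup u j) → u ≡ v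
        ≼-antisym u≤v v≤u =
          Pointwise.Pointwise-≡⇒≡ (extensional⇒inductive (ext λ j → Fin.≤-antisym (u≤v j) (v≤u j)))
      by-cases (no x≢z) = begin
        (if does (x ≟ʷ z) then 1# else - sum)  ≈⟨ reflexive (if-no (x ≟ʷ z) x≢z) ⟩
        - sum                ≈⟨ -‿cong sum≈ ⟩
        - ([ x ≟ʷ z ] - P z) ≈⟨ -‿cong (+-congʳ ([no] (x ≟ʷ z) x≢z)) ⟩
        - (0# - P z)         ≈⟨ -‿cong (+-identityˡ _) ⟩
        - - P z              ≈⟨ ⁻¹-involutive _ ⟩
        P z ∎

  K≈pair : (x w : Word γ n) → K x w ≈ pair (letters x) (λ v → [ v ≟ᵛ letters w ])
  K≈pair {n} x w = begin
    ∑ᶠ (filter (x ≼?_) (words γ n)) (λ z → μ x z * [ z ≟ʷ w ])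
      ≈⟨ ∑-filter (x ≼?_) (words γ n) _ ⟩
    ∑ᶠ (words γ n) (λ z → [ x ≼? z ] * (μ x z * [ z ≟ʷ w ]))
      ≈⟨ preserves-≈ (∑-linear (words γ n)) (λ z → term z (x ≼? z)) ⟩
    ∑ᶠ (words γ n) (λ z → pair (letters x) (λ v → [ v ≟ᵛ letters z ]) * [ letters z ≟ᵛ letters w ])
      ≈⟨ ∑-pair x (λ v → [ v ≟ᵛ letters w ]) ⟩
    pair (letters x) (λ v → [ v ≟ᵛ letters w ]) ∎
    where
    term : ∀ z → Dec (x ≼ z) → [ x ≼? z ] * (μ x z * [ z ≟ʷ w ])
                             ≈ pair (letters x) (λ v → [ v ≟ᵛ letters z ]) * [ z ≟ʷ w ]
    term z (yes x≼z) = trans (*-congʳ ([yes] (x ≼? z) x≼z))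
      (trans (*-identityˡ _) (*-congʳ (μ≈pair x z x≼z)))
    term z (no x⋠z) = trans (trans (*-congʳ ([no] (x ≼? z) x⋠z)) (zeroˡ _))
      (sym (trans (*-congʳ (pair-vanishing {x = x} {z} x⋠z)) (zeroˡ _)))

  ∑-K : (x : Word γ n) (φ : Vec (Letter γ) n → Carrier) →
        ∑ᶠ (words γ n) (λ u → K x u * φ (letters u)) ≈ pair (letters x) φ
  ∑-K {n} x φ =
    trans (preserves-≈ (∑-linear (words γ n)) λ u → *-congʳ (K≈pair x u)) (∑-pair x φ)

  -- Reduction of a composition to the letter at position i.

  pair-cast : (eq : m ≡ n) (x : Vec (Letter γ) m) (φ : Vec (Letter γ) n → Carrier) →
              pair (cast eq x) φ ≈ pair x (φ ∘ cast eq)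
  pair-cast refl x φ = trans
    (reflexive (≡.cong (λ u → pair u φ) (cast-is-id refl x)))
    (preserves-≈ (pair-linear x) λ u → reflexive (≡.cong φ (≡.sym (cast-is-id refl u))))

  pair-++ : (y : Vec (Letter γ) m) (x : Vec (Letter γ) n) (φ : Vec (Letter γ) (m ℕ.+ n) → Carrier) →
            pair (y ++ x) φ ≈ pair y (λ v → pair x (λ u → φ (v ++ u)))
  pair-++ []      x φ = ≈-refl
  pair-++ (b ∷ y) x φ = preserves-≈ (pairLetter-linear b) λ b′ → pair-++ y x (φ ∘ (b′ ∷_))

  -- Only the letter at position i interacts with y. The other letters enter as parameters of the
  -- test function, so an identity for that letter, with any sum on the right, extends to all of x.
  pair-splice : (x : Vec (Letter γ) (ℕ.suc n)) (i : Fin (ℕ.suc n)) (y : Vec (Letter γ) m)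
                (as : List A) (y′ : A → Vec (Letter γ) m) →
                (∀ ψ → pairLetter (lookup x i) (λ a → pair y (ψ ∘ map (a ⊔_)))
                         ≈ ∑ᶠ as (λ a → pair (y′ a) ψ)) →
                ∀ φ → pair x (λ u → pair y (λ v → φ (splice u i (map (lookup u i ⊔_) v))))
                        ≈ ∑ᶠ as (λ a → pair (splice x i (y′ a)) φ)
  pair-splice {n} {m} (c ∷ x) zero y as y′ letterwise φ = begin
    pairLetter c (λ a → pair x (λ u → pair y (λ v → φ (glue (map (a ⊔_) v) u))))
      -- The letters after position i are paired innermost, which makes their pairing a test
      -- function of the block alone.
      ≈⟨ preserves-≈ (pairLetter-linear c) (λ a → pair-swap (pair-linear x) y _) ⟩
    pairLetter c (λ a → pair y (λ v → pair x (λ u → φ (glue (map (a ⊔_) v) u))))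
      ≈⟨ letterwise (λ v → pair x (λ u → φ (glue v u))) ⟩
    ∑ᶠ as (λ a → pair (y′ a) (λ v → pair x (λ u → φ (glue v u))))
      ≈⟨ preserves-≈ (∑-linear as) (λ a → sym (trans
           (pair-cast (ℕ.+-comm m n) (y′ a ++ x) φ) (pair-++ (y′ a) x _))) ⟩
    ∑ᶠ as (λ a → pair (glue (y′ a) x) φ) ∎
    where
    glue : Vec (Letter γ) m → Vec (Letter γ) n → Vec (Letter γ) (n ℕ.+ m)
    glue v u = cast (ℕ.+-comm m n) (v ++ u)
  pair-splice {ℕ.suc _} (c ∷ x) (suc i) y as y′ letterwise φ = begin
    pairLetter c (λ a → pair x (λ u → pair y (λ v → φ (a ∷ splice u i (map (lookup u i ⊔_) v)))))
      ≈⟨ preserves-≈ (pairLetter-linear c) (λ a → pair-splice x i y as y′ letterwise (φ ∘ (a ∷_))) ⟩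
    pairLetter c (λ a → ∑ᶠ as (λ b → pair (splice x i (y′ b)) (φ ∘ (a ∷_))))
      ≈⟨ sym (pairLetter-swap (∑-linear as) c _) ⟩
    ∑ᶠ as (λ b → pairLetter c (λ a → pair (splice x i (y′ b)) (φ ∘ (a ∷_)))) ∎

  -- The effect of max(a, -) on the tensor product of y.

  -- This and `NonzeroBelow` express a ≤ min(y) and min(y) < a letter by letter, which suits
  -- induction: a tail of y may have no nonzero letter.
  NonzeroAbove : Letter γ → Vec (Letter γ) n → Set
  NonzeroAbove a = Allᵛ.All (λ b → b ≢ zero → a ≤ b)

  NonzeroBelow : Letter γ → Vec (Letter γ) n → Set
  NonzeroBelow a = Anyᵛ.Any (λ b → b ≢ zero × b < a)

  NonzeroAbove-Sampled : ∀ {a} {y v : Vec (Letter γ) n} →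
                         NonzeroAbove a y → Sampledᵛ y v → NonzeroAbove a v
  NonzeroAbove-Sampled []       []       = []
  NonzeroAbove-Sampled (p ∷ ps) (s ∷ ss) =
    (λ b≢0 → ℕ.≤-trans (p λ { refl → b≢0 (zero-sampled s) }) (Sampled⇒≤ s)) ∷ NonzeroAbove-Sampled ps ss
    where
    zero-sampled : ∀ {b} → Sampled zero b → b ≡ zero
    zero-sampled stay         = refl
    zero-sampled (step 0≢0 _) = ⊥-elim (0≢0 refl)

  -- What remains of max(a, -) when no nonzero letter is below a. Its values on nonzero letters do
  -- not depend on a.
  fill : Letter γ → Letter γ → Letter γ
  fill a zero    = a
  fill a (suc b) = suc b

  map-⊔≡map-fill : ∀ a (v : Vec (Letter γ) n) → NonzeroAbove a v → map (a ⊔_) v ≡ map (fill a) v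
  map-⊔≡map-fill a []          _        = refl
  map-⊔≡map-fill a (zero  ∷ v) (_ ∷ ps) =
    ≡.cong₂ _∷_ (NaturalMax.x≤y⇒y⊔x≈y (≤-totalOrder _) ℕ.z≤n) (map-⊔≡map-fill a v ps)
  map-⊔≡map-fill a (suc b ∷ v) (p ∷ ps) =
    ≡.cong₂ _∷_ (x≤y⇒x⊔y≈y (p λ ())) (map-⊔≡map-fill a v ps)

  map-maxOrReplace≡map-fill : ∀ c a (v : Vec (Letter γ) n) → NonzeroAbove c v →
                              map (maxOrReplace c a) v ≡ map (fill (suc a)) v
  map-maxOrReplace≡map-fill c a []          _        = refl
  map-maxOrReplace≡map-fill c a (zero  ∷ v) (_ ∷ ps) =
    ≡.cong (suc a ∷_) (map-maxOrReplace≡map-fill c a v ps)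
  map-maxOrReplace≡map-fill c a (suc b ∷ v) (p ∷ ps) =
    ≡.cong₂ _∷_ (x≤y⇒x⊔y≈y (p λ ())) (map-maxOrReplace≡map-fill c a v ps)

  map-fill-id : ∀ a (v : Vec (Letter γ) n) → zeros v ≡ 0 → map (fill a) v ≡ v
  map-fill-id a []          _  = refl
  map-fill-id a (suc b ∷ v) eq = ≡.cong (suc b ∷_) (map-fill-id a v eq)

  pair-⊔≈pair-fill : ∀ a (y : Vec (Letter γ) n) (ψ : Vec (Letter γ) n → Carrier) → NonzeroAbove a y →
                     pair y (ψ ∘ map (a ⊔_)) ≈ pair y (ψ ∘ map (fill a))
  pair-⊔≈pair-fill a y ψ a≤y = pair-cong y λ {v} ss →
    reflexive (≡.cong ψ (map-⊔≡map-fill a v (NonzeroAbove-Sampled a≤y ss)))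

  -- The variable a is visible only at the single 0 of y. The pairing over a therefore moves past
  -- all other letters to that place, where it becomes the factor of c.
  pair-fill : ∀ c (y : Vec (Letter γ) n) (ψ : Vec (Letter γ) n → Carrier) → zeros y ≡ 1 →
              pairLetter c (λ a → pair y (ψ ∘ map (fill a))) ≈ pair (map (fill c) y) ψ
  pair-fill c (zero ∷ y) ψ eq = preserves-≈ (pairLetter-linear c) λ a → begin
    pair y (λ v → ψ (a ∷ map (fill a) v))
      ≈⟨ pair-cong y (λ {v} ss → reflexive (≡.cong (ψ ∘ (a ∷_))
           (map-fill-id a v (≡.trans (zeros-Sampled ss) y≡0)))) ⟩
    pair y (λ v → ψ (a ∷ v))
      ≡⟨ ≡.cong (λ y → pair y (λ v → ψ (a ∷ v))) (map-fill-id c y y≡0) ⟨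
    pair (map (fill c) y) (λ v → ψ (a ∷ v)) ∎
    where y≡0 = ℕ.suc-injective eq
  pair-fill c (b@(suc _) ∷ y) ψ eq = begin
    pairLetter c (λ a → pairLetter b (λ b′ → pair y (λ v → ψ (fill a b′ ∷ map (fill a) v))))
      ≈⟨ preserves-≈ (pairLetter-linear c) (λ a → pairLetter-cong b λ s → preserves-≈ (pair-linear y)
           λ v → reflexive (≡.cong (λ b′ → ψ (b′ ∷ map (fill a) v)) (fill-sampled a s))) ⟩
    pairLetter c (λ a → pairLetter b (λ b′ → pair y (λ v → ψ (b′ ∷ map (fill a) v))))
      ≈⟨ pairLetter-swap (pairLetter-linear c) b _ ⟩
    pairLetter b (λ b′ → pairLetter c (λ a → pair y (λ v → ψ (b′ ∷ map (fill a) v))))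
      ≈⟨ preserves-≈ (pairLetter-linear b) (λ b′ → pair-fill c y (ψ ∘ (b′ ∷_)) eq) ⟩
    pairLetter b (λ b′ → pair (map (fill c) y) (λ v → ψ (b′ ∷ v))) ∎
    where
    fill-sampled : ∀ a {b′} → Sampled b b′ → fill a b′ ≡ b′
    fill-sampled a {zero}  s with () ← Sampled-zero s refl
    fill-sampled a {suc _} s = refl

  -- A nonzero letter b < a contributes max(a, b) − max(a, b + 1) = 0.
  pair-⊔-vanishing : ∀ a (y : Vec (Letter γ) n) (ψ : Vec (Letter γ) n → Carrier) → NonzeroBelow a y →
                     pair y (ψ ∘ map (a ⊔_)) ≈ 0#
  pair-⊔-vanishing a (zero ∷ y) ψ (here (0≢0 , _)) = ⊥-elim (0≢0 refl)
  pair-⊔-vanishing a (b@(suc _) ∷ y) ψ (here (_ , b<a)) with successor b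
  ... | top ≤b _     = ⊥-elim (ℕ.<⇒≱ b<a (≤b a))
  ... | next b⁺ eq s = x≈y⇒x∙y⁻¹≈ε (sym (trans (reflexive (s _)) (reflexive
          (≡.cong (λ l → pair y (λ v → ψ (l ∷ map (a ⊔_) v))) (≡.trans
            (⊔-absorbs (subst (ℕ._≤ toℕ a) (≡.sym eq) b<a))
            (≡.sym (⊔-absorbs (ℕ.<⇒≤ b<a))))))))
    where
    ⊔-absorbs : ∀ {b} → b ≤ a → a ⊔ b ≡ a
    ⊔-absorbs = NaturalMax.x≤y⇒y⊔x≈y (≤-totalOrder _)
  pair-⊔-vanishing a (b ∷ y) ψ (there below) = trans
    (preserves-≈ (pairLetter-linear b) λ b′ → pair-⊔-vanishing a y (ψ ∘ ((a ⊔ b′) ∷_)) below)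
    (preserves-0 (pairLetter-linear b))

  NonzeroBelow-mono : ∀ {a b} {y : Vec (Letter γ) n} → a ≤ b → NonzeroBelow a y → NonzeroBelow b y
  NonzeroBelow-mono a≤b = Anyᵛ.map λ (p , q) → p , ℕ.<-≤-trans q a≤b

  -- Telescoping sums.

  ∑-allFin-suc : (f : Fin (ℕ.suc n) → Carrier) →
                 ∑ᶠ (allFin (ℕ.suc n)) f ≡ f zero + ∑ᶠ (allFin n) (f ∘ suc)
  ∑-allFin-suc {n} f = ≡.cong (f zero +_) (≡.trans
    (≡.cong (λ as → ∑ᶠ as f) (≡.sym (map-tabulate id suc))) (∑-map suc (allFin n) f))

  -- No boundary term is left at the upper end, because `shift` is 0# at the largest element.
  ∑-telescope : (c : Fin n) (g : Fin n → Carrier) →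
                ∑ᶠ (allFin n) (λ a → [ c ≤? a ] * (g a - shift g a)) ≈ g c
  ∑-telescope {ℕ.suc ℕ.zero} zero g = begin
    1# * (g zero - 0#) + 0#   ≈⟨ +-identityʳ _ ⟩
    1# * (g zero - 0#)        ≈⟨ *-identityˡ _ ⟩
    g zero - 0#               ≈⟨ +-congˡ ε⁻¹≈ε ⟩
    g zero + 0#               ≈⟨ +-identityʳ _ ⟩
    g zero                    ∎
  ∑-telescope {ℕ.suc (ℕ.suc n)} zero g = begin
    ∑ᶠ (allFin _) (λ a → 1# * (g a - shift g a))
      ≡⟨ ∑-allFin-suc {ℕ.suc n} (λ a → 1# * (g a - shift g a)) ⟩
    1# * (g zero - g (suc zero)) + ∑ᶠ (allFin _) (λ a → 1# * (g (suc a) - shift (g ∘ suc) a))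
      ≈⟨ +-cong (*-identityˡ _) (∑-telescope zero (g ∘ suc)) ⟩
    g zero - g (suc zero) + g (suc zero)       ≈⟨ +-assoc _ _ _ ⟩
    g zero + (- g (suc zero) + g (suc zero))   ≈⟨ +-congˡ (-‿inverseˡ _) ⟩
    g zero + 0#                                ≈⟨ +-identityʳ _ ⟩
    g zero                                     ∎
  ∑-telescope {ℕ.suc (ℕ.suc n)} (suc c) g = begin
    ∑ᶠ (allFin _) (λ a → [ suc c ≤? a ] * (g a - shift g a))
      ≡⟨ ∑-allFin-suc {ℕ.suc n} (λ a → [ suc c ≤? a ] * (g a - shift g a)) ⟩
    0# * (g zero - g (suc zero))
      + ∑ᶠ (allFin _) (λ a → [ suc c ≤? suc a ] * (g (suc a) - shift (g ∘ suc) a))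
      ≈⟨ +-cong (zeroˡ _) (preserves-≈ (∑-linear (allFin (ℕ.suc n))) (λ a →
           *-congʳ ([-]-cong (suc c ≤? suc a) (c ≤? a) ℕ.s≤s⁻¹ ℕ.s≤s))) ⟩
    0# + ∑ᶠ (allFin _) (λ a → [ c ≤? a ] * (g (suc a) - shift (g ∘ suc) a))
      ≈⟨ +-identityˡ _ ⟩
    ∑ᶠ (allFin _) (λ a → [ c ≤? a ] * (g (suc a) - shift (g ∘ suc) a))
      ≈⟨ ∑-telescope c (g ∘ suc) ⟩
    g (suc c) ∎

  shift-suc : (g : Fin (ℕ.suc n) → Carrier) (a : Fin n) → shift g (suc a) ≡ shift (g ∘ suc) a
  shift-suc {ℕ.suc _} g a = refl

  -- An index `a` of `Fin γ` stands for the letter a + 1, so the telescoping is applied to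
  -- `g ∘ suc`, starting from the predecessor of c.
  ∑-pairLetter : ∀ c (g : Letter γ → Carrier) → c ≢ zero →
                 ∑ᶠ (filter (λ a → c ≤? suc a) (allFin γ)) (λ a → pairLetter (suc a) g) ≈ g c
  ∑-pairLetter zero    g 0≢0 = ⊥-elim (0≢0 refl)
  ∑-pairLetter (suc c) g _   = begin
    ∑ᶠ (filter (λ a → suc c ≤? suc a) (allFin γ)) (λ a → g (suc a) - shift g (suc a))
      ≈⟨ ∑-filter (λ a → suc c ≤? suc a) (allFin γ) _ ⟩
    ∑ᶠ (allFin γ) (λ a → [ suc c ≤? suc a ] * (g (suc a) - shift g (suc a)))
      ≈⟨ preserves-≈ (∑-linear (allFin γ)) (λ a → *-cong
           ([-]-cong (suc c ≤? suc a) (c ≤? a) ℕ.s≤s⁻¹ ℕ.s≤s)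
           (+-congˡ (-‿cong (reflexive (shift-suc g a))))) ⟩
    ∑ᶠ (allFin γ) (λ a → [ c ≤? a ] * (g (suc a) - shift (g ∘ suc) a))
      ≈⟨ ∑-telescope c (g ∘ suc) ⟩
    g (suc c) ∎

  -- The three cases for a single letter.

  minLetter-lowerBound : (y : Word γ (2 ℕ.+ n)) → NonzeroAbove (minLetter y) (letters y)
  minLetter-lowerBound y = Allᵛ.toList⁻ (All.tabulate λ b∈y b≢0 →
    All.lookup (min≤xs (≤-totalOrder _) _ (nonzeroLetters y))
               (∈-filter⁺ (λ b → ¬? (b ≟ zero)) b∈y b≢0))

  minLetter-attained : (y : Word γ (2 ℕ.+ n)) {a : Letter γ} →
                       minLetter y < a → NonzeroBelow a (letters y)
  minLetter-attained y {a} min<a with argmin-sel (≤-totalOrder _) id (fromℕ γ) (nonzeroLetters y)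
  -- The default value γ of the minimum is the largest letter, so it cannot be less than a.
  ... | inj₁ min≡γ = ⊥-elim (ℕ.<⇒≱ (subst (_< a) min≡γ min<a) (Fin.≤fromℕ a))
  ... | inj₂ min∈ with min∈y , min≢0 ← ∈-filter⁻ (λ b → ¬? (b ≟ zero)) min∈ =
    Anyᵛ.toList⁻ (List-Any.map (λ { refl → min≢0 , min<a }) min∈y)

  -- Every letter sampled from c is at most c + 1 ≤ d, hence at most every nonzero letter of y; for
  -- each of them max(a, -) acts as `fill a`.
  pairLetter-above : ∀ c (y : Vec (Letter γ) n) (ψ : Vec (Letter γ) n → Carrier) → zeros y ≡ 1 →
                     ∀ {d} → c < d → NonzeroAbove d y →
                     pairLetter c (λ a → pair y (ψ ∘ map (a ⊔_))) ≈ pair (map (c ⊔_) y) ψ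
  pairLetter-above c y ψ y≡1 c<d d≤y = begin
    pairLetter c (λ a → pair y (ψ ∘ map (a ⊔_)))
      ≈⟨ pairLetter-cong c (λ {a} s → pair-⊔≈pair-fill a y ψ (above (ℕ.≤-trans (Sampled⇒≤suc s) c<d))) ⟩
    pairLetter c (λ a → pair y (ψ ∘ map (fill a)))
      ≈⟨ pair-fill c y ψ y≡1 ⟩
    pair (map (fill c) y) ψ
      ≡⟨ ≡.cong (λ y → pair y ψ) (map-⊔≡map-fill c y (above (ℕ.<⇒≤ c<d))) ⟨
    pair (map (c ⊔_) y) ψ ∎
    where
    above : ∀ {a} → a ≤ _ → NonzeroAbove a y
    above a≤d = Allᵛ.map (λ p b≢0 → ℕ.≤-trans a≤d (p b≢0)) d≤y

  -- The term at c + 1 vanishes since some nonzero letter of y is smaller. The term at c puts the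
  -- plain letter c at the 0 of y, and telescoping expands it into differences.
  pairLetter-equal : ∀ c (y : Vec (Letter γ) n) (ψ : Vec (Letter γ) n → Carrier) → zeros y ≡ 1 →
                     c ≢ zero → NonzeroAbove c y → (∀ {a} → c < a → NonzeroBelow a y) →
                     pairLetter c (λ a → pair y (ψ ∘ map (a ⊔_))) ≈
                     ∑ᶠ (filter (λ a → c ≤? suc a) (allFin γ))
                        (λ a → pair (map (maxOrReplace c a) y) ψ)
  pairLetter-equal zero y ψ _ 0≢0 _ _ = ⊥-elim (0≢0 refl)
  pairLetter-equal c@(suc _) y ψ y≡1 c≢0 c≤y below = begin
    pair y (ψ ∘ map (c ⊔_)) - shift (λ a → pair y (ψ ∘ map (a ⊔_))) c
      ≈⟨ +-congˡ (trans (-‿cong shifted) ε⁻¹≈ε) ⟩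
    pair y (ψ ∘ map (c ⊔_)) + 0#
      ≈⟨ +-identityʳ _ ⟩
    pair y (ψ ∘ map (c ⊔_))
      ≈⟨ pair-⊔≈pair-fill c y ψ c≤y ⟩
    pair y (ψ ∘ map (fill c))
      ≈⟨ ∑-pairLetter c (λ a → pair y (ψ ∘ map (fill a))) c≢0 ⟨
    ∑ᶠ as (λ a → pairLetter (suc a) (λ b → pair y (ψ ∘ map (fill b))))
      ≈⟨ preserves-≈ (∑-linear as) (λ a → trans (pair-fill (suc a) y ψ y≡1) (reflexive
           (≡.cong (λ y → pair y ψ) (≡.sym (map-maxOrReplace≡map-fill c a y c≤y))))) ⟩
    ∑ᶠ as (λ a → pair (map (maxOrReplace c a) y) ψ) ∎
    where
    as = filter (λ a → c ≤? suc a) (allFin γ)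

    shifted : shift (λ a → pair y (ψ ∘ map (a ⊔_))) c ≈ 0#
    shifted with successor c
    ... | top _ s      = reflexive (s _)
    ... | next c⁺ eq s = trans (reflexive (s _))
          (pair-⊔-vanishing c⁺ y ψ (below (ℕ.≤-reflexive (≡.sym eq))))

  -- Letters sampled from c are at least c, so each of them exceeds a nonzero letter of y.
  pairLetter-below : ∀ c (y : Vec (Letter γ) n) (ψ : Vec (Letter γ) n → Carrier) → NonzeroBelow c y →
                     pairLetter c (λ a → pair y (ψ ∘ map (a ⊔_))) ≈ 0#
  pairLetter-below c y ψ below = trans
    (pairLetter-cong c λ {a} s → pair-⊔-vanishing a y ψ (NonzeroBelow-mono (Sampled⇒≤ s) below))
    (preserves-0 (pairLetter-linear c))

  -- From a single letter to the composition of words.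

  -- The coefficient of w in the composition is a double sum, which `∑-K` turns into nested
  -- pairings. The list `as` lets one argument cover a single term, a sum over letters and an empty
  -- sum.
  ∘-K : (x : Word γ (ℕ.suc n)) (i : Fin (ℕ.suc n)) (y : Word γ m) (as : List A)
        (y′ : A → Vec (Letter γ) m) (z : A → Word γ (n ℕ.+ m)) →
        (∀ a → letters (z a) ≡ splice (letters x) i (y′ a)) →
        (∀ ψ → pairLetter (letter x i) (λ a → pair (letters y) (ψ ∘ map (a ⊔_)))
                 ≈ ∑ᶠ as (λ a → pair (y′ a) ψ)) →
        ∀ w → (K x ∘⟨ i ⟩ K y) w ≈ ∑ as (K ∘ z) w
  ∘-K {n} {m} x i y as y′ z z≡ letterwise w = begin
    ∑ᶠ (words γ (ℕ.suc n)) (λ u → ∑ᶠ (words γ m) (λ v → K x u * K y v * φ (letters u) (letters v)))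
      ≈⟨ preserves-≈ (∑-linear (words γ (ℕ.suc n))) (λ u → trans
           (preserves-≈ (∑-linear (words γ m)) (λ v → *-assoc _ _ _))
           (trans (preserves-* (∑-linear (words γ m)) _ _) (*-congˡ (∑-K y (φ (letters u)))))) ⟩
    ∑ᶠ (words γ (ℕ.suc n)) (λ u → K x u * pair (letters y) (φ (letters u)))
      ≈⟨ ∑-K x (λ u → pair (letters y) (φ u)) ⟩
    pair (letters x) (λ u → pair (letters y) (φ u))
      ≈⟨ pair-splice (letters x) i (letters y) as y′ letterwise (λ v → [ v ≟ᵛ letters w ]) ⟩
    ∑ᶠ as (λ a → pair (splice (letters x) i (y′ a)) (λ v → [ v ≟ᵛ letters w ]))
      ≈⟨ preserves-≈ (∑-linear as) (λ a → trans
           (reflexive (≡.cong (λ t → pair t (λ v → [ v ≟ᵛ letters w ])) (≡.sym (z≡ a))))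
           (sym (K≈pair (z a) w))) ⟩
    ∑ᶠ as (λ a → K (z a) w) ∎
    where
    φ : Vec (Letter γ) (ℕ.suc n) → Vec (Letter γ) m → Carrier
    φ u v = [ splice u i (map (lookup u i ⊔_) v) ≟ᵛ letters w ]

open import Data.Nat using (_+_)

theorem2p3p7 : ∀ {c ℓ₁ ℓ₂} (F : HeytingField c ℓ₁ ℓ₂) → CharacteristicZero F →
    (γ : ℕ) → let open Dias F γ in
    ∀ {n m} (x : Word γ (2 + n)) (y : Word γ (2 + m)) (i : Fin (2 + n)) →
    (letter x i < minLetter y → K x ∘⟨ i ⟩ K y ≈ K (x ∘[ i ] y))
    × ((min≡xᵢ : minLetter y ≡ letter x i) →
    K x ∘⟨ i ⟩ K y ≈
    ∑ (filter (λ a → letter x i ≤? suc a) (allFin γ)) λ a →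
    K (compose-replacing x i (subst (_≢ zero) min≡xᵢ (minLetter≢0 y)) a y))
    × (minLetter y < letter x i → K x ∘⟨ i ⟩ K y ≈ 0ᴰ)
theorem2p3p7 F _ γ x y i = above , equal , below
  where
  open Dias F γ
  open Functionals F γ
  open CommutativeRing (HeytingCommutativeRing.commutativeRing (HeytingField.heytingCommutativeRing F))
    using (+-identityʳ; trans; sym)

  above : letter x i < minLetter y → K x ∘⟨ i ⟩ K y ≈ K (x ∘[ i ] y)
  above xᵢ<min w = trans
    -- A one-term sum; the trailing 0# is removed on both levels.
    (∘-K x i y (tt ∷ []) (λ _ → map (letter x i ⊔_) (letters y)) (λ _ → x ∘[ i ] y) (λ _ → refl)
      (λ ψ → trans (pairLetter-above (letter x i) (letters y) ψ (oneZero y) xᵢ<min (minLetter-lowerBound y))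
                   (sym (+-identityʳ _))) w)
    (+-identityʳ _)

  equal : (min≡xᵢ : minLetter y ≡ letter x i) → K x ∘⟨ i ⟩ K y ≈
          ∑ (filter (λ a → letter x i ≤? suc a) (allFin γ)) λ a →
            K (compose-replacing x i (subst (_≢ zero) min≡xᵢ (minLetter≢0 y)) a y)
  equal min≡xᵢ = ∘-K x i y (filter (λ a → letter x i ≤? suc a) (allFin γ))
    (λ a → map (maxOrReplace (letter x i) a) (letters y))
    (λ a → compose-replacing x i (subst (_≢ zero) min≡xᵢ (minLetter≢0 y)) a y) (λ _ → refl)
    (λ ψ → pairLetter-equal (letter x i) (letters y) ψ (oneZero y)
      (subst (_≢ zero) min≡xᵢ (minLetter≢0 y))
      (subst (λ a → NonzeroAbove a (letters y)) min≡xᵢ (minLetter-lowerBound y))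
      (λ {a} xᵢ<a → minLetter-attained y (subst (_< a) (≡.sym min≡xᵢ) xᵢ<a)))

  below : minLetter y < letter x i → K x ∘⟨ i ⟩ K y ≈ 0ᴰ
  -- The empty sum is 0# by definition.
  below min<xᵢ = ∘-K {A = ⊥} x i y [] (λ ()) (λ ()) (λ ())
    (λ ψ → pairLetter-below (letter x i) (letters y) ψ (minLetter-attained y min<xᵢ))
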